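{- Let $\ell\geq 2$ be an integer and let $1\le m\leq n$ be integers. Then $$pc_{1,\ell}(K_{m,n})=\begin{cases} n & \text{if } m=1,\\ 2 & \text{if } m\geq 2 \text{ and } m\leq n\leq 2^m,\\ 3 & \text{if } \ell=2,\ m\geq 2 \text{ and } n>2^m, \text{ or if } \ell\geq 3,\ m\geq 2 \text{ and } 2^m<n\leq 3^m,\\ 4 & \text{if } \ell\geq 3,\ m\geq 2 \text{ and } n>3^m.\end{cases}$$
   Context: $K_{m,n}$ is the complete bipartite graph with parts of sizes $m$ and $n$. An edge-coloring of a graph is an arbitrary map from its edge set to the natural numbers (adjacent edges may share a color). In an edge-colored graph, a path $P$ is a distance $\ell$-proper path if no two edges of $P$ of the same color appear with fewer than $\ell$ edges in between on $P$. For a connected graph $G$, $pc_{1,\ell}(G)$ is the minimum number of colors in an edge-coloring of $G$ such that every pair of distinct vertices of $G$ is connected by at least one distance $\ell$-proper path. -}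

module Defs where

open import Data.Fin.Base using (Fin; toℕ)
open import Data.List.Base using (List; []; _∷_; length; lookup)
open import Data.List.Membership.Propositional using (_∈_)
open import Data.List.Relation.Unary.Unique.Propositional using (Unique)
open import Data.Nat.Base using (ℕ; suc; _∸_; _≤_; _<_)
open import Data.Product.Base using (_×_; ∃-syntax; Σ-syntax)
open import Data.Sum.Base using (_⊎_; inj₁; inj₂)
open import Function.Bundles using (_⇔_)
open import Relation.Binary.Construct.Closure.ReflexiveTransitive using (Star; ε; _◅_)
open import Relation.Binary.Definitions using (Symmetric; Irreflexive)
open import Relation.Binary.PropositionalEquality.Core using (_≡_; _≢_)

record Graph : Set₁ where
  field
    V      : Set
    Adj    : V → V → Set
    sym    : Symmetric Adj
    irrefl : Irreflexive _≡_ Adj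

module _ (G : Graph) where
  open Graph G

  -- `unordered` relates every proof of `Adj u v` to every proof of `Adj v u`;
  -- since `Adj` is symmetric, it also makes the colour independent of the
  -- adjacency proof, so a colouring is exactly a map from unordered edges to ℕ.
  record EdgeColouring : Set where
    field
      colour    : ∀ {u v} → Adj u v → ℕ
      unordered : ∀ {u v} (e : Adj u v) (e′ : Adj v u) → colour e ≡ colour e′

  Walk : V → V → Set
  Walk = Star Adj

  vertices : ∀ {u v} → Walk u v → List V
  vertices {u} ε       = u ∷ []
  vertices {u} (_ ◅ w) = u ∷ vertices w

  IsPath : ∀ {u v} → Walk u v → Set
  IsPath w = Unique (vertices w)

module _ {G : Graph} (c : EdgeColouring G) where
  open Graph G
  open EdgeColouring c

  colours : ∀ {u v} → Walk G u v → List ℕ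
  colours ε       = []
  colours (e ◅ w) = colour e ∷ colours w

  -- The edges in positions i < j of a path have j ∸ suc i edges in between.
  DistanceProper : ℕ → ∀ {u v} → Walk G u v → Set
  DistanceProper ℓ w =
    ∀ (i j : Fin (length (colours w))) → toℕ i < toℕ j →
    toℕ j ∸ suc (toℕ i) < ℓ → lookup (colours w) i ≢ lookup (colours w) j

  DistanceProperConnected : ℕ → Set
  DistanceProperConnected ℓ =
    ∀ (u v : V) → u ≢ v →
    Σ[ w ∈ Walk G u v ] IsPath G w × DistanceProper ℓ w

  -- The image of the colouring has exactly k elements, as witnessed by a
  -- duplicate-free enumeration of it.
  UsesColours : ℕ → Set
  UsesColours k =
    Σ[ cs ∈ List ℕ ] Unique cs × length cs ≡ k ×
      (∀ x → x ∈ cs ⇔ (∃[ u ] ∃[ v ] Σ[ e ∈ Adj u v ] colour e ≡ x))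

-- `pc[1, ℓ ] G ≔ k` says that the minimum defining pc_{1,ℓ}(G) exists and equals k.
-- Connectedness of G is not a separate hypothesis: it is implied by the
-- existence of a distance-ℓ-proper connected colouring.
pc[1,_]_≔_ : ℕ → Graph → ℕ → Set
pc[1, ℓ ] G ≔ k =
  (Σ[ c ∈ EdgeColouring G ] DistanceProperConnected c ℓ × UsesColours c k) ×
  (∀ (c : EdgeColouring G) (j : ℕ) →
     DistanceProperConnected c ℓ → UsesColours c j → k ≤ j)

data BipartiteAdj (m n : ℕ) : Fin m ⊎ Fin n → Fin m ⊎ Fin n → Set where
  left-right : ∀ i j → BipartiteAdj m n (inj₁ i) (inj₂ j)
  right-left : ∀ i j → BipartiteAdj m n (inj₂ j) (inj₁ i)

K : ℕ → ℕ → Graph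
K m n = record
  { V      = Fin m ⊎ Fin n
  ; Adj    = BipartiteAdj m n
  ; sym    = λ { (left-right i j) → right-left i j
               ; (right-left i j) → left-right i j }
  ; irrefl = λ { _≡_.refl () }
  }

{-# OPTIONS --safe #-}

-- A distance-ℓ-proper path repeats no colour among ℓ + 1 consecutive edges.
-- Colour K m n by j colours and read the colours at a right vertex as a word
-- of length m. If j ^ m < n, two right vertices carry the same word, so a
-- proper path between them is not of length 2; having length at least 4, it
-- shows min (4, ℓ + 1) ≤ j and 2 ≤ m. Conversely, if the rows and the columns
-- of the colour matrix are pairwise distinct, paths of length at most 2 suffice.
-- When there are too many columns for that, give all columns but one the colours
-- a, b in the first two rows, and give the remaining one c, d: then
-- a, c, d, b is the colour sequence of a path joining any two of the former.
-- For ℓ = 2 one may take a = b, so that three colours are enough.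

module Submission where

open import Data.Fin.Base using (Fin; zero; suc; toℕ; inject≤; finToFun; funToFin; combine)
open import Data.Fin.Properties using (_≟_; all?; any?; toℕ-injective; toℕ<n; toℕ-inject≤; inject≤-injective; <-cmp; <⇒≢; pigeonhole; injective⇒≤; <⇒notInjective; funToFin-finToFin; finToFun-funToFin; ¬∀⟶∃¬)
open import Data.List.Base using (List; []; _∷_; length; lookup; tabulate)
open import Data.List.Membership.Propositional using (_∈_)
open import Data.List.Membership.Propositional.Properties using (∈-lookup; ∈-tabulate⁺; ∈-tabulate⁻)
import Data.List.Membership.Setoid.Properties as Membership
open import Data.List.Properties using (length-tabulate)
open import Data.List.Relation.Unary.All as All using (All; []; _∷_)
open import Data.List.Relation.Unary.AllPairs using ([]; _∷_)
open import Data.List.Relation.Unary.Any using (here; there; index)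
open import Data.List.Relation.Unary.Unique.Propositional using (Unique)
open import Data.List.Relation.Unary.Unique.Propositional.Properties using (tabulate⁺)
open import Data.Nat.Base using (ℕ; zero; suc; _∸_; _≤_; _<_; _≤′_; ≤′-reflexive; ≤′-step; _^_; z≤n; s≤s; s≤s⁻¹)
import Data.Nat.Properties as ℕ
open import Data.Nat.Properties using (≤-refl; ≤-trans; <-≤-trans; ≤-<-trans; m∸n≤m; n≤1+n; ≤⇒≤′; ≮⇒≥; ^-monoˡ-≤; ^-identityʳ; _<?_)
open import Data.List.Relation.Unary.Unique.DecPropositional ℕ._≟_ using (unique?)
open import Data.Product.Base using (_×_; _,_; proj₁; proj₂; ∃-syntax; Σ-syntax; ∃₂; uncurry)
open import Data.Sum.Base using (_⊎_; inj₁; inj₂)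
open import Data.Sum.Properties using (inj₂-injective)
open import Data.Vec.Functional using (updateAt)
open import Data.Vec.Functional.Properties using (updateAt-updates; updateAt-minimal)
open import Function.Base using (_∘_; const)
open import Function.Bundles using (mk⇔; Equivalence)
open import Function.Definitions using (Injective)
open import Relation.Binary.Construct.Closure.ReflexiveTransitive using (ε; _◅_)
open import Relation.Binary.Definitions using (tri<; tri≈; tri>)
open import Relation.Binary.PropositionalEquality.Core using (_≡_; _≢_; refl; sym; trans; cong; subst; subst₂; ≢-sym; cong₂; _≗_)
open import Relation.Binary.PropositionalEquality.Properties using (setoid; subst-injective)
open import Relation.Nullary using (yes; no; ¬_; ¬?; contradiction)
open import Relation.Nullary.Decidable using (from-yes; decidable-stable; _→-dec_)
open import Defs

-- Finite sets, injections and words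

distinct⇒2≤ : ∀ {m} {i j : Fin m} → i ≢ j → 2 ≤ m
distinct⇒2≤ {suc zero}    {zero} {zero} i≢j = contradiction refl i≢j
distinct⇒2≤ {suc (suc m)} i≢j = s≤s (s≤s z≤n)

lookup-distinct : ∀ {A : Set} {xs : List A} → Unique xs →
                  ∀ i j → toℕ i < toℕ j → lookup xs i ≢ lookup xs j
lookup-distinct (x∉xs ∷ _)  zero    (suc j) _   = All.lookup x∉xs (∈-lookup j)
lookup-distinct (_ ∷ xs!)   (suc i) (suc j) i<j = lookup-distinct xs! i j (s≤s⁻¹ i<j)

-- If every value were attained, choosing preimages would inject the larger set into the smaller
-- one.
missed : ∀ {m n} → m < n → (f : Fin m → Fin n) → ∃[ y ] (∀ i → f i ≢ y)
missed {n = n} m<n f = proj₁ gap , λ i fi≡y → proj₂ gap (i , fi≡y)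
  where
  not-onto : ¬ (∀ y → ∃[ i ] f i ≡ y)
  not-onto onto = <⇒notInjective m<n
    (λ {y} {y′} eq → trans (sym (proj₂ (onto y))) (trans (cong f eq) (proj₂ (onto y′))))

  gap = ¬∀⟶∃¬ n (λ y → ∃[ i ] f i ≡ y) (λ y → any? (λ i → f i ≟ y)) not-onto

-- Serves to enlarge a prescribed set of columns to `n` distinct ones. Each step puts a missed value
-- at `zero` and shifts the earlier values, so `f` keeps the values of `e` but not their indices.
extend-injection : ∀ {m n N} (e : Fin m → Fin N) → Injective _≡_ _≡_ e → m ≤′ n → n ≤ N →
  Σ[ f ∈ (Fin n → Fin N) ] Injective _≡_ _≡_ f × (∀ i → ∃[ y ] f y ≡ e i)
extend-injection e e-inj (≤′-reflexive refl) _ = e , e-inj , λ i → i , refl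
extend-injection {n = suc n} {N} e e-inj (≤′-step m≤n) n<N
  with f , f-inj , f-hits ← extend-injection e e-inj m≤n (≤-trans (n≤1+n n) n<N)
  with y , y-missed ← missed n<N f
  = f′ , f′-inj , λ i → suc (proj₁ (f-hits i)) , proj₂ (f-hits i)
  where
  f′ : Fin (suc n) → Fin N
  f′ zero    = y
  f′ (suc i) = f i

  f′-inj : Injective _≡_ _≡_ f′
  f′-inj {zero}  {zero}  _  = refl
  f′-inj {zero}  {suc j} eq = contradiction (sym eq) (y-missed j)
  f′-inj {suc i} {zero}  eq = contradiction eq (y-missed i)
  f′-inj {suc i} {suc j} eq = cong suc (f-inj eq)

-- Without function extensionality, words are compared pointwise; this and the next two lemmas carry
-- such equalities to and from their codes.
funToFin-cong : ∀ {m k} {f g : Fin m → Fin k} → f ≗ g → funToFin f ≡ funToFin g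
funToFin-cong {zero}  _   = refl
funToFin-cong {suc m} f≗g = cong₂ combine (f≗g zero) (funToFin-cong (f≗g ∘ suc))

finToFun-injective : ∀ {m k} {x y : Fin (k ^ m)} → finToFun {k} {m} x ≗ finToFun y → x ≡ y
finToFun-injective {m} {k} {x} {y} eq =
  trans (sym (funToFin-finToFin {m} {k} x)) (trans (funToFin-cong eq) (funToFin-finToFin {m} {k} y))

funToFin-injective : ∀ {m k} {f g : Fin m → Fin k} → funToFin f ≡ funToFin g → f ≗ g
funToFin-injective {f = f} {g} eq i =
  trans (sym (finToFun-funToFin f i))
        (trans (cong (λ x → finToFun x i) eq) (finToFun-funToFin g i))

-- Lower bounds

module _ {G : Graph} (c : EdgeColouring G) {k : ℕ} (uses : UsesColours c k) where
  open Graph G using (Adj)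
  open EdgeColouring c

  private
    cs = proj₁ uses

  colour∈ : ∀ {u v} (e : Adj u v) → colour e ∈ cs
  colour∈ {u} {v} e = Equivalence.from (proj₂ (proj₂ (proj₂ uses)) (colour e)) (u , v , e , refl)

  colours∈ : ∀ {u v} (w : Walk G u v) → All (_∈ cs) (colours c w)
  colours∈ ε       = []
  colours∈ (e ◅ w) = colour∈ e ∷ colours∈ w

  -- Numbers the colours in use by `Fin k`, so that the pigeonhole principle can count them.
  position : ∀ {x} → x ∈ cs → Fin k
  position x∈cs = subst Fin (proj₁ (proj₂ (proj₂ uses))) (index x∈cs)

  position-injective : ∀ {x y} (x∈cs : x ∈ cs) (y∈cs : y ∈ cs) →
                       position x∈cs ≡ position y∈cs → x ≡ y
  position-injective x∈cs y∈cs eq =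
    Membership.index-injective (setoid ℕ) x∈cs y∈cs
      (subst-injective (proj₁ (proj₂ (proj₂ uses))) eq)

  -- Among the first `s` edges any two have at most `s - 2 < ℓ` edges in between, so these edges
  -- have `s` distinct colours.
  proper-prefix≤colours : ∀ {ℓ s u v} (w : Walk G u v) → DistanceProper c ℓ w →
                             s ≤ suc ℓ → s ≤ length (colours c w) → s ≤ k
  proper-prefix≤colours {ℓ} {s} w proper s≤1+ℓ s≤len = injective⇒≤ {f = f} f-inj
    where
    at : Fin s → Fin (length (colours c w))
    at i = inject≤ i s≤len

    at∈ : ∀ i → lookup (colours c w) (at i) ∈ cs
    at∈ i = All.lookup (colours∈ w) (∈-lookup (at i))

    f : Fin s → Fin k
    f i = position (at∈ i)

    differ : ∀ i j → toℕ i < toℕ j → f i ≢ f j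
    differ i (suc j) i<j eq = proper (at i) (at (suc j))
      (subst₂ _<_ (sym (toℕ-inject≤ i s≤len)) (sym (toℕ-inject≤ (suc j) s≤len)) i<j)
      close
      (position-injective (at∈ i) (at∈ (suc j)) eq)
      where
      close : toℕ (at (suc j)) ∸ suc (toℕ (at i)) < ℓ
      -- The successors cancel, leaving at most `toℕ j`, and `suc (toℕ j) < s ≤ suc ℓ`.
      close rewrite toℕ-inject≤ (suc j) s≤len =
        ≤-<-trans (m∸n≤m (toℕ j) (toℕ (at i))) (s≤s⁻¹ (<-≤-trans (toℕ<n (suc j)) s≤1+ℓ))

    f-inj : Injective _≡_ _≡_ f
    f-inj {i} {j} eq with <-cmp i j
    ... | tri< i<j _ _ = contradiction eq (differ i j i<j)
    ... | tri≈ _ i≡j _ = i≡j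
    ... | tri> _ _ j<i = contradiction (sym eq) (differ j i j<i)

module _ {m n : ℕ} (c : EdgeColouring (K m n)) where
  open EdgeColouring c

  rows-length : ∀ {i i′} → i ≢ i′ → (w : Walk (K m n) (inj₁ i) (inj₁ i′)) →
                2 ≤ length (colours c w)
  rows-length i≢i′ ε           = contradiction refl i≢i′
  rows-length i≢i′ (_ ◅ _ ◅ _) = s≤s (s≤s z≤n)

  -- Bipartiteness makes the length even. Length 2 would give adjacent edges of one colour; a longer
  -- path has at least four edges and visits two distinct left vertices.
  twins-length : ∀ {ℓ} y y′ → 1 ≤ ℓ → y ≢ y′ →
    (∀ i → colour (right-left i y) ≡ colour (right-left i y′)) →
    (w : Walk (K m n) (inj₂ y) (inj₂ y′)) → IsPath (K m n) w → DistanceProper c ℓ w →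
    2 ≤ m × 4 ≤ length (colours c w)
  twins-length _ _ 1≤ℓ y≢y′ twins ε _ _ = contradiction refl y≢y′
  twins-length _ _ 1≤ℓ y≢y′ twins (right-left i y ◅ left-right .i y′ ◅ ε) _ proper =
    contradiction (trans (twins i) (unordered (right-left i y′) (left-right i y′)))
      (proper zero (suc zero) (s≤s z≤n) 1≤ℓ)
  twins-length _ _ 1≤ℓ y≢y′ twins (right-left i _ ◅ left-right .i _ ◅ right-left i′ _ ◅ _ ◅ w)
    (_ ∷ (_ ∷ i≢i′ ∷ _) ∷ _) _ =
    distinct⇒2≤ (i≢i′ ∘ cong inj₁) , s≤s (s≤s (s≤s (s≤s z≤n)))

  twin-columns : ∀ {k} → UsesColours c k → k ^ m < n →
    ∃₂ λ y y′ → y ≢ y′ × (∀ i → colour (right-left i y) ≡ colour (right-left i y′))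
  twin-columns {k} uses k^m<n =
    let y , y′ , y<y′ , eq = pigeonhole k^m<n (funToFin ∘ word)
    in y , y′ , <⇒≢ y<y′ , λ i → position-injective c uses (colour∈ c uses (right-left i y))
                                   (colour∈ c uses (right-left i y′))
                                   (funToFin-injective {f = word y} {word y′} eq i)
    where
    word : Fin n → Fin m → Fin k
    word y i = position c uses (colour∈ c uses (right-left i y))

  pigeonhole-bound : ∀ {ℓ k s} → 1 ≤ ℓ → DistanceProperConnected c ℓ → UsesColours c k →
                     k ^ m < n → s ≤ suc ℓ → s ≤ 4 → 2 ≤ m × s ≤ k
  pigeonhole-bound 1≤ℓ conn uses k^m<n s≤1+ℓ s≤4
    with y , y′ , y≢y′ , twins ← twin-columns uses k^m<n
    with w , path , proper ← conn (inj₂ y) (inj₂ y′) (y≢y′ ∘ inj₂-injective)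
    with 2≤m , 4≤len ← twins-length y y′ 1≤ℓ y≢y′ twins w path proper
    = 2≤m , proper-prefix≤colours c uses w proper s≤1+ℓ (≤-trans s≤4 4≤len)

  1+p≤colours : ∀ {ℓ k p} → 1 ≤ ℓ → p ≤ ℓ → p ≤ 3 → p ^ m < n →
                DistanceProperConnected c ℓ → UsesColours c k → suc p ≤ k
  1+p≤colours {k = k} {p} 1≤ℓ p≤ℓ p≤3 p^m<n conn uses with p <? k
  ... | yes p<k = p<k
  -- Here `k ≤ p`, so `k ^ m ≤ p ^ m < n` and twin columns exist.
  ... | no  p≮k = proj₂ (pigeonhole-bound 1≤ℓ conn uses
          (≤-<-trans (^-monoˡ-≤ m (≮⇒≥ p≮k)) p^m<n) (s≤s p≤ℓ) (s≤s p≤3))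

2≤colours : ∀ {ℓ m n k} → 1 ≤ ℓ → 2 ≤ m → (c : EdgeColouring (K m n)) →
            DistanceProperConnected c ℓ → UsesColours c k → 2 ≤ k
2≤colours 1≤ℓ (s≤s (s≤s _)) c conn uses
  with w , _ , proper ← conn (inj₁ zero) (inj₁ (suc zero)) (λ ())
  = proper-prefix≤colours c uses w proper (s≤s 1≤ℓ) (rows-length c (λ ()) w)

star-colours : ∀ {ℓ n k} → 1 ≤ ℓ → (c : EdgeColouring (K 1 n)) →
               DistanceProperConnected c ℓ → UsesColours c k → n ≤ k
star-colours {n = n} {k} 1≤ℓ c conn uses with k <? n
... | no  k≮n = ≮⇒≥ k≮n
... | yes k<n
  -- Fewer than `n` colours would give twin columns, and a proper path between them needs two left
  -- vertices, while the star has only one.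
  with s≤s () , _ ← pigeonhole-bound c 1≤ℓ conn uses (subst (_< n) (sym (^-identityʳ k)) k<n) z≤n z≤n

-- Colourings given by a matrix

matrixColouring : ∀ {m n k} → (Fin m → Fin n → Fin k) → EdgeColouring (K m n)
matrixColouring M = record
  { colour    = λ { (left-right i y) → toℕ (M i y) ; (right-left i y) → toℕ (M i y) }
  ; unordered = λ { (left-right i y) (right-left .i .y) → refl
                  ; (right-left i y) (left-right .i .y) → refl }
  }

ProperPath : ∀ {G} → EdgeColouring G → ℕ → Graph.V G → Graph.V G → Set
ProperPath {G} c ℓ u v = Σ[ w ∈ Walk G u v ] IsPath G w × DistanceProper c ℓ w

rainbow⇒proper : ∀ {ℓ} {xs : List ℕ} → Unique xs → ∀ (i j : Fin (length xs)) → toℕ i < toℕ j →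
  toℕ j ∸ suc (toℕ i) < ℓ → lookup xs i ≢ lookup xs j
rainbow⇒proper xs! i j i<j _ = lookup-distinct xs! i j i<j

module _ {m n k : ℕ} (M : Fin m → Fin n → Fin k) where
  private
    c = matrixColouring M

  matrix-uses : (∀ x → ∃₂ λ i y → M i y ≡ x) → UsesColours c k
  matrix-uses onto =
    tabulate toℕ , tabulate⁺ toℕ-injective , length-tabulate toℕ , λ x → mk⇔ to from
    where
    to : ∀ {x} → x ∈ tabulate toℕ →
         ∃[ u ] ∃[ v ] Σ[ e ∈ BipartiteAdj m n u v ] EdgeColouring.colour c e ≡ x
    to x∈ =
      let z , x≡z = ∈-tabulate⁻ {f = toℕ} x∈
          i , y , eq = onto z
      in inj₁ i , inj₂ y , left-right i y , trans (cong toℕ eq) (sym x≡z)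

    from : ∀ {x} → (∃[ u ] ∃[ v ] Σ[ e ∈ BipartiteAdj m n u v ] EdgeColouring.colour c e ≡ x) →
           x ∈ tabulate toℕ
    from (_ , _ , left-right i y , refl) = ∈-tabulate⁺ (M i y)
    from (_ , _ , right-left i y , refl) = ∈-tabulate⁺ (M i y)

  columns-path : ∀ {ℓ y y′} i → M i y ≢ M i y′ → ProperPath c ℓ (inj₂ y) (inj₂ y′)
  columns-path {y = y} {y′} i differ =
    right-left i y ◅ left-right i y′ ◅ ε ,
    ((λ ()) ∷ (λ { refl → differ refl }) ∷ []) ∷ ((λ ()) ∷ []) ∷ [] ∷ [] ,
    rainbow⇒proper ((differ ∘ toℕ-injective ∷ []) ∷ [] ∷ [])

  rows-path : ∀ {ℓ i i′} y → M i y ≢ M i′ y → ProperPath c ℓ (inj₁ i) (inj₁ i′)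
  rows-path {i = i} {i′} y differ =
    left-right i y ◅ right-left i′ y ◅ ε ,
    ((λ ()) ∷ (λ { refl → differ refl }) ∷ []) ∷ ((λ ()) ∷ []) ∷ [] ∷ [] ,
    rainbow⇒proper ((differ ∘ toℕ-injective ∷ []) ∷ [] ∷ [])

  -- Vertices in opposite parts are adjacent. Rows are always joined by two edges, whereas for
  -- columns the path is left open, since twin columns need a longer one.
  matrix-connected : ∀ {ℓ} →
    (∀ {i i′} → i ≢ i′ → ∃[ y ] M i y ≢ M i′ y) →
    (∀ {y y′} → y ≢ y′ → ProperPath c ℓ (inj₂ y) (inj₂ y′)) →
    DistanceProperConnected c ℓ
  matrix-connected rows cols (inj₁ i) (inj₁ i′) i≢i′ = uncurry rows-path (rows (i≢i′ ∘ cong inj₁))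
  matrix-connected rows cols (inj₂ y) (inj₂ y′) y≢y′ = cols (y≢y′ ∘ cong inj₂)
  matrix-connected rows cols (inj₁ i) (inj₂ y)  _    =
    left-right i y ◅ ε , ((λ ()) ∷ []) ∷ [] ∷ [] , rainbow⇒proper ([] ∷ [])
  matrix-connected rows cols (inj₂ y) (inj₁ i)  _    =
    right-left i y ◅ ε , ((λ ()) ∷ []) ∷ [] ∷ [] , rainbow⇒proper ([] ∷ [])

-- Upper bounds

Attains : ℕ → ℕ → ℕ → ℕ → Set
Attains ℓ m n k = Σ[ c ∈ EdgeColouring (K m n) ] DistanceProperConnected c ℓ × UsesColours c k

star-attains : ∀ {ℓ n} → Attains ℓ 1 n n
star-attains =
  matrixColouring M ,
  matrix-connected M (λ { {zero} {zero} 0≢0 → contradiction refl 0≢0 }) (columns-path M zero) ,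
  matrix-uses M (λ y → zero , y , refl)
  where
  M : ∀ {n} → Fin 1 → Fin n → Fin n
  M _ y = y

-- For `b = zero` this is a multiple of the `i`-th unit vector.
spike : ∀ {A : Set} {m} → A → A → Fin m → Fin m → A
spike b x i = updateAt (const b) i (const x)

spike-at : ∀ {A : Set} {m} {b x : A} (i : Fin m) → spike b x i i ≡ x
spike-at i = updateAt-updates i _

spike-off : ∀ {A : Set} {m} {b x : A} {i r : Fin m} → r ≢ i → spike b x i r ≡ b
spike-off {i = i} {r} = updateAt-minimal r i _

-- A set of columns containing a multiple of each unit vector separates the rows.
distinct-columns-attains : ∀ {ℓ m n p} → 2 ≤ m → m ≤ n → n ≤ suc p ^ m →
  (d : Fin m → Fin p) → (∀ x → ∃[ i ] d i ≡ x) → Attains ℓ m n (suc p)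
distinct-columns-attains {ℓ} {m@(suc (suc _))} {n} {p} (s≤s (s≤s _)) m≤n n≤ d d-onto =
  matrixColouring M , matrix-connected M rows cols , matrix-uses M onto
  where
  -- The entry `suc (d i)` is nonzero, and surjectivity of `d` makes every nonzero colour occur.
  e : Fin m → Fin m → Fin (suc p)
  e i = spike zero (suc (d i)) i

  e-injective : Injective _≡_ _≡_ (funToFin ∘ e)
  -- At position `i` the word `e i` is nonzero, while `e j` is zero there.
  e-injective {i} {j} eq = decidable-stable (i ≟ j) λ i≢j →
    contradiction
      (trans (sym (spike-at i)) (trans (funToFin-injective {f = e i} {e j} eq i) (spike-off i≢j)))
      λ ()

  extension = extend-injection (funToFin ∘ e) e-injective (≤⇒≤′ m≤n) n≤

  f : Fin n → Fin (suc p ^ m)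
  f = proj₁ extension

  M : Fin m → Fin n → Fin (suc p)
  M i y = finToFun (f y) i

  column : Fin m → Fin n
  column i = proj₁ (proj₂ (proj₂ extension) i)

  M-column : ∀ i r → M r (column i) ≡ e i r
  M-column i r = trans (cong (λ x → finToFun x r) (proj₂ (proj₂ (proj₂ extension) i)))
                       (finToFun-funToFin (e i) r)

  M-on : ∀ i → M i (column i) ≡ suc (d i)
  M-on i = trans (M-column i i) (spike-at i)

  M-off : ∀ {i r} → r ≢ i → M r (column i) ≡ zero
  M-off {i} {r} r≢i = trans (M-column i r) (spike-off r≢i)

  rows : ∀ {i i′} → i ≢ i′ → ∃[ y ] M i y ≢ M i′ y
  rows {i} i≢i′ = column i , λ eq →
    contradiction (trans (sym (M-on i)) (trans eq (M-off (≢-sym i≢i′)))) λ ()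

  cols : ∀ {y y′} → y ≢ y′ → ProperPath (matrixColouring M) ℓ (inj₂ y) (inj₂ y′)
  cols {y} {y′} y≢y′ with any? (λ i → ¬? (M i y ≟ M i y′))
  ... | yes (i , differ) = columns-path M i differ
  ... | no  same         = contradiction
    (proj₁ (proj₂ extension) (finToFun-injective {m} {suc p} λ i →
      decidable-stable (M i y ≟ M i y′) (λ differ → same (i , differ))))
    y≢y′

  onto : ∀ x → ∃₂ λ i y → M i y ≡ x
  -- Colour zero occurs off the diagonal, which takes a second row.
  onto zero    = suc zero , column zero , M-off {zero} {suc zero} λ ()
  onto (suc x) with i , refl ← d-onto x = i , column i , M-on i

-- Column zero reads `c, d, c, c, …` and every other column starts with `a, b`. The lower rows only
-- have to make all rows distinct. The condition on `xs` is properness of the path coloured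
-- `a, c, d, b`; `a` and `b` may coincide.
twin-columns-attains : ∀ {ℓ m n k} → 2 ≤ m → m ≤ n → (a b c d : Fin k) →
  a ≢ c → b ≢ c → c ≢ d →
  (∀ x → x ∈ a ∷ b ∷ c ∷ d ∷ []) →
  (let xs = toℕ a ∷ toℕ c ∷ toℕ d ∷ toℕ b ∷ [] in
    ∀ (i j : Fin 4) → toℕ i < toℕ j → toℕ j ∸ suc (toℕ i) < ℓ → lookup xs i ≢ lookup xs j) →
  Attains ℓ m n k
twin-columns-attains {ℓ} {suc (suc m)} {suc (suc n)} {k} (s≤s (s≤s _)) (s≤s 1+m≤1+n@(s≤s _))
  a b c d a≢c b≢c c≢d all proper =
  matrixColouring M , matrix-connected M rows cols , matrix-uses M (onto ∘ all)
  where
  column : Fin m → Fin (suc n)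
  -- Column `suc (column r)` has the same index as row `suc (suc r)`, so the entries `c` placed
  -- below lie on the diagonal.
  column r = inject≤ (suc r) 1+m≤1+n

  M : Fin (suc (suc m)) → Fin (suc (suc n)) → Fin k
  M zero          zero    = c
  M (suc zero)    zero    = d
  M (suc (suc _)) zero    = c
  M zero          (suc _) = a
  M (suc zero)    (suc _) = b
  -- The spike runs along the row. In its column, `c` differs from `a` in row zero, from `b` in row
  -- one and from `a` in every other lower row.
  M (suc (suc r)) (suc j) = spike a c (column r) j

  M-on : ∀ r → M (suc (suc r)) (suc (column r)) ≡ c
  M-on r = spike-at (column r)

  rows : ∀ {i i′} → i ≢ i′ → ∃[ y ] M i y ≢ M i′ y
  rows {zero}        {zero}         i≢i′ = contradiction refl i≢i′
  rows {zero}        {suc zero}     _    = zero , c≢d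
  rows {zero}        {suc (suc r)}  _    = suc (column r) , subst (a ≢_) (sym (M-on r)) a≢c
  rows {suc zero}    {zero}         _    = zero , ≢-sym c≢d
  rows {suc zero}    {suc zero}     i≢i′ = contradiction refl i≢i′
  rows {suc zero}    {suc (suc r)}  _    = suc (column r) , subst (b ≢_) (sym (M-on r)) b≢c
  rows {suc (suc r)} {zero}         _    = suc (column r) , subst (_≢ a) (sym (M-on r)) (≢-sym a≢c)
  rows {suc (suc r)} {suc zero}     _    = suc (column r) , subst (_≢ b) (sym (M-on r)) (≢-sym b≢c)
  rows {suc (suc r)} {suc (suc r′)} i≢i′ = suc (column r) , λ eq →
    a≢c (trans (sym (spike-off column-distinct)) (trans (sym eq) (M-on r)))
    where
    column-distinct : column r ≢ column r′
    column-distinct eq = i≢i′ (cong suc (inject≤-injective 1+m≤1+n 1+m≤1+n (suc r) (suc r′) eq))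

  cols : ∀ {y y′} → y ≢ y′ → ProperPath (matrixColouring M) ℓ (inj₂ y) (inj₂ y′)
  cols {zero}  {zero}   y≢y′ = contradiction refl y≢y′
  cols {zero}  {suc y′} _    = columns-path M zero (≢-sym a≢c)
  cols {suc y} {zero}   _    = columns-path M zero a≢c
  cols {suc y} {suc y′} y≢y′ =
    right-left zero (suc y) ◅ left-right zero zero ◅
      right-left (suc zero) zero ◅ left-right (suc zero) (suc y′) ◅ ε ,
    ((λ ()) ∷ (λ ()) ∷ (λ ()) ∷ (y≢y′ ∘ inj₂-injective) ∷ []) ∷
      ((λ ()) ∷ (λ ()) ∷ (λ ()) ∷ []) ∷ ((λ ()) ∷ (λ ()) ∷ []) ∷ ((λ ()) ∷ []) ∷ [] ∷ [] ,
    proper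

  onto : ∀ {x} → x ∈ a ∷ b ∷ c ∷ d ∷ [] → ∃₂ λ i y → M i y ≡ x
  onto (here refl)                         = zero , suc zero , refl
  onto (there (here refl))                 = suc zero , suc zero , refl
  onto (there (there (here refl)))         = zero , zero , refl
  onto (there (there (there (here refl)))) = suc zero , zero , refl

two-attained : ∀ {ℓ m n} → 2 ≤ m → m ≤ n → n ≤ 2 ^ m → Attains ℓ m n 2
two-attained 2≤m@(s≤s _) m≤n n≤2^m =
  distinct-columns-attains 2≤m m≤n n≤2^m (λ _ → zero) λ { zero → zero , refl }

three-attained : ∀ {ℓ m n} → 2 ≤ m → m ≤ n → n ≤ 3 ^ m → Attains ℓ m n 3
three-attained 2≤m@(s≤s (s≤s _)) m≤n n≤3^m =
  -- This `d` is 1 in the first row and 0 in all others, so it takes both values once there are two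
  -- rows.
  distinct-columns-attains 2≤m m≤n n≤3^m (spike zero (suc zero) zero)
    λ { zero → suc zero , refl ; (suc zero) → zero , refl }

-- The two edges coloured 0 in `0, 1, 2, 0` have exactly two edges in between, which distance 2
-- permits. Properness is a finite check, decided by evaluation.
three-attained-ℓ≡2 : ∀ {m n} → 2 ≤ m → m ≤ n → Attains 2 m n 3
three-attained-ℓ≡2 2≤m m≤n =
  twin-columns-attains {k = 3} 2≤m m≤n zero zero (suc zero) (suc (suc zero))
    (λ ()) (λ ()) (λ ())
    (λ { zero → here refl ; (suc zero) → there (there (here refl))
       ; (suc (suc zero)) → there (there (there (here refl))) })
    (from-yes (all? λ i → all? λ j →
      toℕ i <? toℕ j →-dec (toℕ j ∸ suc (toℕ i) <? 2 →-dec ¬? (lookup xs i ℕ.≟ lookup xs j))))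
  where
  xs : List ℕ
  xs = 0 ∷ 1 ∷ 2 ∷ 0 ∷ []

-- With `a` and `b` different the connecting path is rainbow, hence proper for every `ℓ`.
four-attained : ∀ {ℓ m n} → 2 ≤ m → m ≤ n → Attains ℓ m n 4
four-attained 2≤m m≤n =
  twin-columns-attains {k = 4} 2≤m m≤n zero (suc zero) (suc (suc zero)) (suc (suc (suc zero)))
    (λ ()) (λ ()) (λ ())
    (λ { zero → here refl ; (suc zero) → there (here refl)
       ; (suc (suc zero)) → there (there (here refl))
       ; (suc (suc (suc zero))) → there (there (there (here refl))) })
    (rainbow⇒proper (from-yes (unique? (0 ∷ 2 ∷ 3 ∷ 1 ∷ []))))

theorem2p7 : ∀ (ℓ m n : ℕ) → 2 ≤ ℓ → 1 ≤ m → m ≤ n →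
    (m ≡ 1 → pc[1, ℓ ] K m n ≔ n) ×
    (2 ≤ m × m ≤ n × n ≤ 2 ^ m → pc[1, ℓ ] K m n ≔ 2) ×
    ((ℓ ≡ 2 × 2 ≤ m × 2 ^ m < n) ⊎ (3 ≤ ℓ × 2 ≤ m × 2 ^ m < n × n ≤ 3 ^ m) → pc[1, ℓ ] K m n ≔ 3) ×
    (3 ≤ ℓ × 2 ≤ m × 3 ^ m < n → pc[1, ℓ ] K m n ≔ 4)
theorem2p7 ℓ m n 2≤ℓ 1≤m m≤n =
  (λ { refl → star-attains , λ c _ → star-colours 1≤ℓ c }) ,
  (λ { (2≤m , _ , n≤2^m) → two-attained 2≤m m≤n n≤2^m , λ c _ → 2≤colours 1≤ℓ 2≤m c }) ,
  (λ { (inj₁ (refl , 2≤m , 2^m<n))      → three-attained-ℓ≡2 2≤m m≤n , three-needed 2^m<n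
     ; (inj₂ (_ , 2≤m , 2^m<n , n≤3^m)) → three-attained 2≤m m≤n n≤3^m , three-needed 2^m<n }) ,
  (λ { (3≤ℓ , 2≤m , 3^m<n) →
       four-attained 2≤m m≤n , λ c _ → 1+p≤colours c 1≤ℓ 3≤ℓ ≤-refl 3^m<n })
  where
  1≤ℓ : 1 ≤ ℓ
  1≤ℓ = ≤-trans (n≤1+n 1) 2≤ℓ

  -- Both cases with value 3 share this bound, which needs only `2 ≤ ℓ`; excluding three colours
  -- takes four distinct edge colours, hence `3 ≤ ℓ`.
  three-needed : 2 ^ m < n → ∀ (c : EdgeColouring (K m n)) j →
                 DistanceProperConnected c ℓ → UsesColours c j → 3 ≤ j
  three-needed 2^m<n c _ = 1+p≤colours c 1≤ℓ 2≤ℓ (n≤1+n 2) 2^m<n
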